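{- Let $p$ be prime and $k,n\in\mathbb{N}$. Then $$\operatorname{rank}_{\mathbb{Z}/p\mathbb{Z}}(\mathcal{A}^*_{p^k,n})\leq 2n\binom{\lfloor p^k/2\rfloor+(n-1)(p-1)+n}{n}.$$
   Context: Let $R=\mathbb{Z}/p^k\mathbb{Z}$. For $x,y\in R^n$, $\langle x,y\rangle=\sum_i x_iy_i\in R$. Let $\mathbb{S}^{n-1}(R)$ be the set of vectors in $R^n$ having at least one coordinate invertible in $R$, and $\mathbb{P}R^{n-1}=\mathbb{S}^{n-1}(R)/R^\times$ (nondegenerate directions; $b\sim\lambda b$ for $\lambda\in R^\times$). For $a\in R^n$ and $b\in\mathbb{P}R^{n-1}$, $H_b(a)=\{x\in R^n:\langle x-a,b\rangle=0\text{ in }R\}$. The matrix $\mathcal{A}^*_{p^k,n}$ has rows indexed by $(a,b)\in R^n\times\mathbb{P}R^{n-1}$, columns indexed by $x\in R^n$, and entry $1$ if $x\in H_b(a)$, $0$ otherwise; rank is over $\mathbb{Z}/p\mathbb{Z}$. -}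

module Defs where

open import Data.Nat using (ℕ; zero; suc; _+_; _*_; _∸_; _^_; _≤_; NonZero)
open import Data.Nat.DivMod using (_%_)
open import Data.Nat.Divisibility using (_∣_)
open import Data.Nat.Primality using (Prime; prime⇒nonZero)
open import Data.Nat.Properties using (_≟_; m^n≢0)
open import Data.Fin using (Fin; zero; suc; toℕ; _<_)
open import Data.Product using (Σ; ∃; _×_; _,_)
open import Relation.Nullary using (¬_; does)
open import Relation.Binary.PropositionalEquality using (_≡_)
open import Data.Bool using (if_then_else_)

sumF : ∀ {t} → (Fin t → ℕ) → ℕ
sumF {zero}  f = 0
sumF {suc t} f = f zero + sumF (λ i → f (suc i))

-- A matrix with integer entries (read mod p), rows indexed by I, columns by C.
-- A family of rows r : Fin t → I is linearly independent over ℤ/pℤ: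
-- every vanishing ℤ/pℤ-linear combination (coefficients c i read mod p)
-- has all coefficients ≡ 0 (mod p).
LinIndepRows : (p : ℕ) {I C : Set} (M : I → C → ℕ) {t : ℕ} (r : Fin t → I) → Set
LinIndepRows p {C = C} M {t} r =
  (c : Fin t → ℕ) →
  (∀ (x : C) → p ∣ sumF (λ i → c i * M (r i) x)) →
  ∀ i → p ∣ c i

RankAtMost : (p : ℕ) {I C : Set} (M : I → C → ℕ) (B : ℕ) → Set
RankAtMost p {I} M B = ∀ (t : ℕ) (r : Fin t → I) → LinIndepRows p M r → t ≤ B

module Ring (m : ℕ) .{{_ : NonZero m}} where

  R : Set
  R = Fin m

  Vect : ℕ → Set
  Vect n = Fin n → R

  IsUnit : R → Set
  IsUnit u = ∃ λ v → (toℕ u * v) % m ≡ 1 % m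

  dot : ∀ {n} → Vect n → Vect n → ℕ
  dot x b = sumF (λ i → toℕ (x i) * toℕ (b i))

  -- ℙR^{n-1}: one canonical representative per class of 𝕊^{n-1}(R)/R^×,
  -- namely the b whose first invertible coordinate equals 1.
  Normalized : ∀ {n} → Vect n → Set
  Normalized {n} b = Σ (Fin n) λ i →
    IsUnit (b i) × (toℕ (b i) % m ≡ 1 % m) × (∀ (j : Fin n) → j < i → ¬ IsUnit (b j))

  Proj : ℕ → Set
  Proj n = Σ (Vect n) Normalized

  RowIdx : ℕ → Set
  RowIdx n = Vect n × Proj n

  -- x ∈ H_b(a)  ⟺  ⟨x - a , b⟩ = 0 in R  ⟺  ⟨x,b⟩ ≡ ⟨a,b⟩ (mod m)
  -- entry of 𝒜*_{m,n} at row (a,b), column x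
  entry : ∀ {n} → RowIdx n → Vect n → ℕ
  entry (a , (b , _)) x = if does (dot x b % m ≟ dot a b % m) then 1 else 0

module _ (p : ℕ) (pr : Prime p) (k : ℕ) where
  private
    instance
      nzp : NonZero p
      nzp = prime⇒nonZero pr
      nzq : NonZero (p ^ k)
      nzq = m^n≢0 p k

  AstarRow : ℕ → Set
  AstarRow n = Ring.RowIdx (p ^ k) n

  AstarCol : ℕ → Set
  AstarCol n = Ring.Vect (p ^ k) n

  Astar : (n : ℕ) → AstarRow n → AstarCol n → ℕ
  Astar n = Ring.entry (p ^ k)

{-# OPTIONS --safe #-}

-- Put z = 1 + u in 𝔽_p[[u]] and q = p^k.  As z^q = 1 + u^q, the coefficient of
-- u^(q-1) in z^s is 1 if s ≡ -1 (mod q) and 0 otherwise, so the row of (a , b)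
-- is x ↦ [u^(q-1)] z^(⟨x,b⟩ + e) with e depending on (a , b) only.  Some
-- coordinate b_i is 1; for the others expand z^(x_j b_j) by Newton interpolation
-- at the nodes 1, z, z², …: it is a combination, with coefficients independent of
-- x, of the ∏_{l<d} (z^(x_j) - z^l) = [x_j choose d]_z ∏_{l<d} (z^d - z^l).
-- Since u^(p^v) divides z^l - 1 whenever p^v divides l, the last product is
-- divisible by u^w with w ≥ 2d - 2(p-1).  Hence the rows with b_i = 1 lie in the
-- span of the coefficients of u^c in z^(x_i) ∏_{j≠i} [x_j choose d_j]_z with
-- |d| ≤ D = ⌊q/2⌋ + (n-1)(p-1) and c < 2(D - |d| + 1), and there are
-- 2 (D + n choose n) of these.
module Submission where

open import Defs
open import Algebra.Bundles using (CommutativeRing)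
open import Data.Bool.Base using (Bool; true; false; if_then_else_)
open import Data.Empty using (⊥-elim)
open import Data.Fin.Base using (Fin; zero; suc; toℕ; fromℕ; inject₁; punchIn)
import Data.Fin.Properties as Fin
open import Data.Integer.Base as ℤ using (ℤ; +_)
import Data.Integer.DivMod as ℤ
import Data.Integer.Divisibility.Signed as ℤ∣
import Data.Integer.Properties as ℤ
import Data.Integer.Tactic.RingSolver as ℤSolver
open import Data.List.Base using (List; []; _∷_; length; _++_; applyUpTo; concat; tabulate)
open import Data.List.Membership.Propositional using (_∈_)
open import Data.List.Membership.Propositional.Properties using (∈-++⁺ˡ; ∈-++⁺ʳ; ∈-applyUpTo⁺)
import Data.List.Properties as List
open import Data.List.Relation.Unary.Any using (here; there)
open import Data.Nat.Base as ℕ using (ℕ; zero; suc; z≤n; s≤s; NonZero)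
open import Data.Nat.Combinatorics using (_C_; nC1≡n; nCn≡1; nCk+nC[k+1]≡[n+1]C[k+1])
import Data.Nat.Divisibility as ℕ∣
import Data.Nat.DivMod as ℕ
open import Data.Nat.Primality using (Prime; euclidsLemma; prime⇒nonZero; prime⇒nonTrivial)
import Data.Nat.Properties as ℕ
import Data.Nat.Tactic.RingSolver as ℕSolver
open import Data.Product.Base using (_,_; ∃; _×_; proj₁; proj₂)
open import Data.Sum.Base as Sum using (_⊎_; inj₁; inj₂; [_,_]′)
open import Data.Vec.Functional using (insertAt)
open import Data.Vec.Functional.Properties using (insertAt-lookup; insertAt-punchIn)
open import Function.Base using (_∘_)
open import Level using (0ℓ; _⊔_)
open import Relation.Binary.Definitions using (tri<; tri≈; tri>)
open import Relation.Binary.PropositionalEquality as ≡ using (_≡_)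
import Relation.Binary.Reasoning.Setoid as SetoidReasoning
open import Relation.Nullary using (¬_; Dec; yes; no; does)
open import Relation.Nullary.Decidable using (¬?; decidable-stable; dec-true; dec-false)

-- The integers modulo p, as a ring on ℤ whose equality is congruence.

module ModularIntegers (p : ℕ) where

  infix 4 _≋_
  -- A record, because `a` and `b` could not be inferred from the divisibility of `a - b` alone.
  record _≋_ (a b : ℤ) : Set where
    constructor mod
    field divides : + p ℤ∣.∣ a ℤ.- b
  open _≋_ public

  private
    via : ∀ {a b c} → c ≡ a ℤ.- b → + p ℤ∣.∣ c → a ≋ b
    via ≡.refl d = mod d

  reflexive : ∀ {a b} → a ≡ b → a ≋ b
  reflexive {a} ≡.refl = mod (ℤ∣.divides (+ 0) (ℤ.+-inverseʳ a))

  ring : CommutativeRing 0ℓ 0ℓ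
  ring = record
    { Carrier = ℤ ; _≈_ = _≋_
    ; _+_ = ℤ._+_ ; _*_ = ℤ._*_ ; -_ = ℤ.-_ ; 0# = + 0 ; 1# = + 1
    ; isCommutativeRing = record
      { isRing = record
        { +-isAbelianGroup = record
          { isGroup = record
            { isMonoid = record
              { isSemigroup = record
                { isMagma = record
                  { isEquivalence = record
                    { refl = reflexive ≡.refl
                    ; sym = λ { {a} {b} (mod d) → via (neg-diff a b) (ℤ∣.∣m⇒∣-m d) }
                    ; trans = λ { {a} {b} {c} (mod d) (mod e) → via (telescope a b c) (ℤ∣.∣m∣n⇒∣m+n d e) }
                    }
                  ; ∙-cong = λ { {a} {b} {c} {d} (mod x) (mod y) → via (diff-+ a b c d) (ℤ∣.∣m∣n⇒∣m+n x y) }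
                  }
                ; assoc = λ a b c → reflexive (ℤ.+-assoc a b c)
                }
              ; identity = (λ a → reflexive (ℤ.+-identityˡ a)) , (λ a → reflexive (ℤ.+-identityʳ a))
              }
            ; inverse = (λ a → reflexive (ℤ.+-inverseˡ a)) , (λ a → reflexive (ℤ.+-inverseʳ a))
            ; ⁻¹-cong = λ { {a} {b} (mod d) → via (diff-neg a b) (ℤ∣.∣m⇒∣-m d) }
            }
          ; comm = λ a b → reflexive (ℤ.+-comm a b)
          }
        ; *-cong = λ { {a} {b} {c} {d} (mod x) (mod y) →
            via (diff-* a b c d) (ℤ∣.∣m∣n⇒∣m+n (ℤ∣.∣m⇒∣m*n c x) (ℤ∣.∣n⇒∣m*n b y)) }
        ; *-assoc = λ a b c → reflexive (ℤ.*-assoc a b c)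
        ; *-identity = (λ a → reflexive (ℤ.*-identityˡ a)) , (λ a → reflexive (ℤ.*-identityʳ a))
        ; distrib = (λ a b c → reflexive (ℤ.*-distribˡ-+ a b c)) , (λ a b c → reflexive (ℤ.*-distribʳ-+ a b c))
        }
      ; *-comm = λ a b → reflexive (ℤ.*-comm a b)
      }
    }
    where
    neg-diff : ∀ a b → ℤ.- (a ℤ.- b) ≡ b ℤ.- a
    neg-diff = ℤSolver.solve-∀
    telescope : ∀ a b c → (a ℤ.- b) ℤ.+ (b ℤ.- c) ≡ a ℤ.- c
    telescope = ℤSolver.solve-∀
    diff-+ : ∀ a b c d → (a ℤ.- b) ℤ.+ (c ℤ.- d) ≡ (a ℤ.+ c) ℤ.- (b ℤ.+ d)
    diff-+ = ℤSolver.solve-∀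
    diff-neg : ∀ a b → ℤ.- (a ℤ.- b) ≡ ℤ.- a ℤ.- (ℤ.- b)
    diff-neg = ℤSolver.solve-∀
    diff-* : ∀ a b c d → (a ℤ.- b) ℤ.* c ℤ.+ b ℤ.* (c ℤ.- d) ≡ a ℤ.* c ℤ.- b ℤ.* d
    diff-* = ℤSolver.solve-∀

  ≋0⇒∣ : ∀ {a} → a ≋ + 0 → p ℕ∣.∣ ℤ.∣ a ∣
  ≋0⇒∣ {a} (mod d) = ℤ∣.∣⇒∣ᵤ (≡.subst (+ p ℤ∣.∣_) (ℤ.+-identityʳ a) d)

  ∣⇒≋0 : ∀ {a} → p ℕ∣.∣ ℤ.∣ a ∣ → a ≋ + 0
  ∣⇒≋0 {a} d = via (≡.sym (ℤ.+-identityʳ a)) (ℤ∣.∣ᵤ⇒∣ d)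

  _≋0? : ∀ a → Dec (a ≋ + 0)
  a ≋0? with p ℕ∣.∣? ℤ.∣ a ∣
  ... | yes d = yes (∣⇒≋0 d)
  ... | no ¬d = no (λ e → ¬d (≋0⇒∣ e))

  *-integral : Prime p → ∀ {a b} → a ℤ.* b ≋ + 0 → a ≋ + 0 ⊎ b ≋ + 0
  *-integral pr {a} {b} e = Sum.map ∣⇒≋0 ∣⇒≋0
    (euclidsLemma ℤ.∣ a ∣ ℤ.∣ b ∣ pr (≡.subst (p ℕ∣.∣_) (ℤ.abs-* a b) (≋0⇒∣ e)))

-- Formal power series over a commutative ring.

module PowerSeries {c ℓ} (F : CommutativeRing c ℓ) where
  open CommutativeRing F hiding (zero)
  open SetoidReasoning setoid
  open import Algebra.Solver.Ring.NaturalCoefficients.Default commutativeSemiring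

  Series : Set c
  Series = ℕ → Carrier

  infix 4 _≐_
  _≐_ : Series → Series → Set ℓ
  f ≐ g = ∀ k → f k ≈ g k

  infixl 6 _⊹_
  infixl 7 _⋆_

  _⊹_ : Series → Series → Series
  (f ⊹ g) k = f k + g k

  ⊖_ : Series → Series
  (⊖ f) k = - f k

  shift : Series → Series
  shift f k = f (suc k)

  const : Carrier → Series
  const a zero    = a
  const a (suc k) = 0#

  -- f ⋆ g = f₀ g + X (shift f ⋆ g)
  _⋆_ : Series → Series → Series
  (f ⋆ g) zero    = f 0 * g 0
  (f ⋆ g) (suc k) = f 0 * g (suc k) + (shift f ⋆ g) k

  ⋆-cong : ∀ {f f′ g g′} → f ≐ f′ → g ≐ g′ → f ⋆ g ≐ f′ ⋆ g′
  ⋆-cong f≐ g≐ zero    = *-cong (f≐ 0) (g≐ 0)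
  ⋆-cong f≐ g≐ (suc k) = +-cong (*-cong (f≐ 0) (g≐ (suc k))) (⋆-cong (λ i → f≐ (suc i)) g≐ k)

  -- The recursion defining `⋆` peels off the constant term of the left factor; this mirror image
  -- does it on the right, so that commutativity follows by induction.
  ⋆-unfoldʳ : ∀ f g k → (f ⋆ g) (suc k) ≈ f (suc k) * g 0 + (f ⋆ shift g) k
  ⋆-unfoldʳ f g zero    = +-comm _ _
  ⋆-unfoldʳ f g (suc k) = begin
    f 0 * g (suc (suc k)) + (shift f ⋆ g) (suc k)
      ≈⟨ +-congˡ (⋆-unfoldʳ (shift f) g k) ⟩
    f 0 * g (suc (suc k)) + (f (suc (suc k)) * g 0 + (shift f ⋆ shift g) k)
      ≈⟨ solve 3 (λ x y w → x :+ (y :+ w) := y :+ (x :+ w)) refl _ _ _ ⟩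
    f (suc (suc k)) * g 0 + (f 0 * g (suc (suc k)) + (shift f ⋆ shift g) k) ∎

  ⋆-comm : ∀ f g → f ⋆ g ≐ g ⋆ f
  ⋆-comm f g zero    = *-comm _ _
  ⋆-comm f g (suc k) = begin
    f 0 * g (suc k) + (shift f ⋆ g) k  ≈⟨ +-cong (*-comm _ _) (⋆-comm (shift f) g k) ⟩
    g (suc k) * f 0 + (g ⋆ shift f) k  ≈⟨ ⋆-unfoldʳ g f k ⟨
    (g ⋆ f) (suc k)                    ∎

  ⋆-distribʳ : ∀ h f g → (f ⊹ g) ⋆ h ≐ f ⋆ h ⊹ g ⋆ h
  ⋆-distribʳ h f g zero    = distribʳ _ _ _
  ⋆-distribʳ h f g (suc k) = begin
    (f 0 + g 0) * h (suc k) + ((shift f ⊹ shift g) ⋆ h) k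
      ≈⟨ +-congˡ (⋆-distribʳ h (shift f) (shift g) k) ⟩
    (f 0 + g 0) * h (suc k) + ((shift f ⋆ h) k + (shift g ⋆ h) k)
      ≈⟨ solve 5 (λ a b x y w → (a :+ b) :* x :+ (y :+ w) := (a :* x :+ y) :+ (b :* x :+ w)) refl _ _ _ _ _ ⟩
    (f ⋆ h) (suc k) + (g ⋆ h) (suc k) ∎

  ⋆-scale : ∀ a f g → (λ k → a * f k) ⋆ g ≐ (λ k → a * (f ⋆ g) k)
  ⋆-scale a f g zero    = *-assoc _ _ _
  ⋆-scale a f g (suc k) = begin
    a * f 0 * g (suc k) + ((λ i → a * f (suc i)) ⋆ g) k  ≈⟨ +-cong (*-assoc _ _ _) (⋆-scale a (shift f) g k) ⟩
    a * (f 0 * g (suc k)) + a * (shift f ⋆ g) k          ≈⟨ distribˡ _ _ _ ⟨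
    a * (f ⋆ g) (suc k)                                  ∎

  ⋆-assoc : ∀ f g h → (f ⋆ g) ⋆ h ≐ f ⋆ (g ⋆ h)
  ⋆-assoc f g h zero    = *-assoc _ _ _
  ⋆-assoc f g h (suc k) = begin
    f 0 * g 0 * h (suc k) + (((λ i → f 0 * g (suc i)) ⊹ shift f ⋆ g) ⋆ h) k
      ≈⟨ +-congˡ (⋆-distribʳ h _ _ k) ⟩
    f 0 * g 0 * h (suc k) + (((λ i → f 0 * g (suc i)) ⋆ h) k + ((shift f ⋆ g) ⋆ h) k)
      ≈⟨ +-congˡ (+-cong (⋆-scale (f 0) (shift g) h k) (⋆-assoc (shift f) g h k)) ⟩
    f 0 * g 0 * h (suc k) + (f 0 * (shift g ⋆ h) k + (shift f ⋆ (g ⋆ h)) k)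
      ≈⟨ solve 5 (λ a b x y w → a :* b :* x :+ (a :* y :+ w) := a :* (b :* x :+ y) :+ w) refl _ _ _ _ _ ⟩
    (f ⋆ (g ⋆ h)) (suc k) ∎

  ⋆-zeroˡ : ∀ g → (λ _ → 0#) ⋆ g ≐ (λ _ → 0#)
  ⋆-zeroˡ g zero    = zeroˡ _
  ⋆-zeroˡ g (suc k) = trans (+-cong (zeroˡ _) (⋆-zeroˡ g k)) (+-identityˡ 0#)

  ⋆-const : ∀ a g → const a ⋆ g ≐ (λ k → a * g k)
  ⋆-const a g zero    = refl
  ⋆-const a g (suc k) = trans (+-congˡ (⋆-zeroˡ g k)) (+-identityʳ _)

  ⋆-identityˡ : ∀ g → const 1# ⋆ g ≐ g
  ⋆-identityˡ g k = trans (⋆-const 1# g k) (*-identityˡ _)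

  seriesRing : CommutativeRing c ℓ
  seriesRing = record
    { Carrier = Series ; _≈_ = _≐_
    ; _+_ = _⊹_ ; _*_ = _⋆_ ; -_ = ⊖_ ; 0# = λ _ → 0# ; 1# = const 1#
    ; isCommutativeRing = record
      { isRing = record
        { +-isAbelianGroup = record
          { isGroup = record
            { isMonoid = record
              { isSemigroup = record
                { isMagma = record
                  { isEquivalence = record
                    { refl  = λ k → refl
                    ; sym   = λ e k → sym (e k)
                    ; trans = λ e e′ k → trans (e k) (e′ k)
                    }
                  ; ∙-cong = λ e e′ k → +-cong (e k) (e′ k)
                  }
                ; assoc = λ f g h k → +-assoc _ _ _
                }
              ; identity = (λ f k → +-identityˡ _) , (λ f k → +-identityʳ _)
              }
            ; inverse = (λ f k → -‿inverseˡ _) , (λ f k → -‿inverseʳ _)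
            ; ⁻¹-cong = λ e k → -‿cong (e k)
            }
          ; comm = λ f g k → +-comm _ _
          }
        ; *-cong = ⋆-cong
        ; *-assoc = ⋆-assoc
        ; *-identity = ⋆-identityˡ , (λ f k → trans (⋆-comm f (const 1#) k) (⋆-identityˡ f k))
        ; distrib = (λ f g h k → trans (⋆-comm f (g ⊹ h) k)
                      (trans (⋆-distribʳ f g h k) (+-cong (⋆-comm g f k) (⋆-comm h f k))))
                  , ⋆-distribʳ
        }
      ; *-comm = ⋆-comm
      }
    }

  open import Algebra.Properties.Semiring.Exp (CommutativeRing.semiring seriesRing)
    using () renaming (_^_ to _⋆^_) public
  open import Algebra.Properties.Semiring.Mult (CommutativeRing.semiring seriesRing)
    using () renaming (_×_ to _⋆×_) public
  open import Algebra.Properties.Semiring.Mult semiring using () renaming (_×_ to _·_)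

  X : Series
  X zero    = 0#
  X (suc k) = const 1# k

  X⋆-zero : ∀ f → (X ⋆ f) 0 ≈ 0#
  X⋆-zero f = zeroˡ _

  X⋆-suc : ∀ f k → (X ⋆ f) (suc k) ≈ f k
  X⋆-suc f k = trans (+-cong (zeroˡ _) (⋆-identityˡ f k)) (+-identityˡ _)

  X^⋆-< : ∀ w f {k} → k ℕ.< w → (X ⋆^ w ⋆ f) k ≈ 0#
  X^⋆-< (suc w) f {zero}  _         = trans (⋆-assoc X (X ⋆^ w) f 0) (X⋆-zero (X ⋆^ w ⋆ f))
  X^⋆-< (suc w) f {suc k} (s≤s k<w) =
    trans (⋆-assoc X (X ⋆^ w) f (suc k)) (trans (X⋆-suc (X ⋆^ w ⋆ f) k) (X^⋆-< w f k<w))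

  X^⋆-+ : ∀ w f k → (X ⋆^ w ⋆ f) (w ℕ.+ k) ≈ f k
  X^⋆-+ zero    f k = ⋆-identityˡ f k
  X^⋆-+ (suc w) f k =
    trans (⋆-assoc X (X ⋆^ w) f (suc (w ℕ.+ k))) (trans (X⋆-suc (X ⋆^ w ⋆ f) (w ℕ.+ k)) (X^⋆-+ w f k))

  -- This is z = 1 + u of the overview, with `X` as u.
  Z : Series
  Z = const 1# ⊹ X

  Z⋆-suc : ∀ f k → (Z ⋆ f) (suc k) ≈ f (suc k) + f k
  Z⋆-suc f k = trans (⋆-distribʳ f (const 1#) X (suc k)) (+-cong (⋆-identityˡ f (suc k)) (X⋆-suc f k))

  Z^-> : ∀ s {k} → s ℕ.< k → (Z ⋆^ s) k ≈ 0#
  Z^-> zero    {suc k} _         = refl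
  Z^-> (suc s) {suc k} (s≤s s<k) = trans (Z⋆-suc (Z ⋆^ s) k)
    (trans (+-cong (Z^-> s (ℕ.m<n⇒m<1+n s<k)) (Z^-> s s<k)) (+-identityˡ 0#))

  Z^-leading : ∀ s → (Z ⋆^ s) s ≈ 1#
  Z^-leading zero    = refl
  Z^-leading (suc s) = trans (Z⋆-suc (Z ⋆^ s) s)
    (trans (+-cong (Z^-> s (ℕ.n<1+n s)) (Z^-leading s)) (+-identityˡ 1#))

  -- Carries the hypothesis p = 0 from the coefficient ring to the series ring.
  ⋆×-const : ∀ n → n ⋆× const 1# ≐ const (n · 1#)
  ⋆×-const zero    zero    = refl
  ⋆×-const zero    (suc k) = refl
  ⋆×-const (suc n) zero    = +-congˡ (⋆×-const n 0)
  ⋆×-const (suc n) (suc k) = trans (+-identityˡ _) (⋆×-const n (suc k))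

-- Divisibility of binomial coefficients by a prime.

absorption : ∀ n k → suc k ℕ.* (suc n C suc k) ≡ suc n ℕ.* (n C k)
absorption n       zero    = ≡.trans (ℕ.*-identityˡ _) (≡.trans (nC1≡n (suc n)) (≡.sym (ℕ.*-identityʳ _)))
absorption zero    (suc k) = ℕ.*-zeroʳ (suc (suc k))
absorption (suc n) (suc k) = begin
  suc (suc k) ℕ.* (suc (suc n) C suc (suc k))
    ≡⟨ ≡.cong (suc (suc k) ℕ.*_) (nCk+nC[k+1]≡[n+1]C[k+1] (suc n) (suc k)) ⟨
  suc (suc k) ℕ.* (c₁ ℕ.+ c₂)
    ≡⟨ split (suc k) c₁ c₂ ⟩
  c₁ ℕ.+ (suc k ℕ.* c₁ ℕ.+ suc (suc k) ℕ.* c₂)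
    ≡⟨ ≡.cong (c₁ ℕ.+_) (≡.cong₂ ℕ._+_ (absorption n k) (absorption n (suc k))) ⟩
  c₁ ℕ.+ (suc n ℕ.* (n C k) ℕ.+ suc n ℕ.* (n C suc k))
    ≡⟨ ≡.cong (c₁ ℕ.+_) (ℕ.*-distribˡ-+ (suc n) (n C k) (n C suc k)) ⟨
  c₁ ℕ.+ suc n ℕ.* (n C k ℕ.+ n C suc k)
    ≡⟨ ≡.cong (λ c → c₁ ℕ.+ suc n ℕ.* c) (nCk+nC[k+1]≡[n+1]C[k+1] n k) ⟩
  suc (suc n) ℕ.* c₁ ∎
  where
  open ≡.≡-Reasoning
  c₁ = suc n C suc k
  c₂ = suc n C suc (suc k)
  split : ∀ m a b → suc m ℕ.* (a ℕ.+ b) ≡ a ℕ.+ (m ℕ.* a ℕ.+ suc m ℕ.* b)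
  split = ℕSolver.solve-∀

-- By `absorption`, p divides the product of k + 1 and the binomial coefficient, and it cannot
-- divide k + 1, which is positive and below p.
prime∣binomial : ∀ {p} → Prime p → ∀ k → suc k ℕ.< p → p ℕ∣.∣ (p C suc k)
prime∣binomial {suc p} pr k k<p
  with euclidsLemma (suc k) (suc p C suc k) pr
         (≡.subst (suc p ℕ∣.∣_) (≡.sym (absorption p k)) (ℕ∣.m∣m*n (p C k)))
... | inj₁ p∣k = ⊥-elim (ℕ.<⇒≱ k<p (ℕ∣.∣⇒≤ p∣k))
... | inj₂ p∣C = p∣C

-- Frobenius in characteristic p and factors of z^m - 1.

module Frobenius {c ℓ} (R : CommutativeRing c ℓ) (p : ℕ) (pr : Prime p) where
  open CommutativeRing R hiding (zero)
  open SetoidReasoning setoid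
  open import Algebra.Properties.Semiring.Exp semiring
  open import Algebra.Properties.Semiring.Mult semiring
    using (×-assocˡ; ×-assoc-*; ×-congʳ; ×-homo-1) renaming (_×_ to _·_)
  open import Algebra.Properties.Semiring.Sum semiring
  open import Algebra.Properties.CommutativeSemiring.Binomial commutativeSemiring using (theorem; binomialTerm)
  open import Algebra.Properties.AbelianGroup +-abelianGroup using (xyx⁻¹≈y)
  open import Algebra.Properties.CommutativeSemigroup.Divisibility *-commutativeSemigroup using (_∣_; _,_)

  sum-zero : ∀ {n} (t : Fin n → Carrier) → (∀ i → t i ≈ 0#) → sum t ≈ 0#
  sum-zero {n} t t≈0 = trans (sum-cong-≋ t≈0) (sum-replicate-zero n)

  1^ : ∀ n → 1# ^ n ≈ 1#
  1^ zero    = refl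
  1^ (suc n) = trans (*-identityˡ _) (1^ n)

  -- The witness is the sum of (1 + v)^i over i < n; it exhibits v as a divisor of (1 + v)^n - 1.
  geometric : ∀ v n → ∃ λ g → (1# + v) ^ n ≈ 1# + v * g
  geometric v zero    = 0# , sym (trans (+-congˡ (zeroʳ v)) (+-identityʳ 1#))
  geometric v (suc n) with geometric v n
  ... | g , eq = (1# + v) ^ n + g , (begin
    (1# + v) * (1# + v) ^ n           ≈⟨ distribʳ _ _ _ ⟩
    1# * (1# + v) ^ n + v * (1# + v) ^ n ≈⟨ +-congʳ (trans (*-identityˡ _) eq) ⟩
    1# + v * g + v * (1# + v) ^ n     ≈⟨ +-assoc _ _ _ ⟩
    1# + (v * g + v * (1# + v) ^ n)   ≈⟨ +-congˡ (trans (+-comm _ _) (sym (distribˡ _ _ _))) ⟩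
    1# + v * ((1# + v) ^ n + g)       ∎)

  module _ (p·1≈0 : p · 1# ≈ 0#) where

    p∣n⇒n·≈0 : ∀ {n} → p ℕ∣.∣ n → ∀ x → n · x ≈ 0#
    p∣n⇒n·≈0 (ℕ∣.divides q ≡.refl) x = begin
      (q ℕ.* p) · x        ≈⟨ ×-assocˡ x q p ⟨
      q · (p · x)          ≈⟨ ×-congʳ q (×-congʳ p (*-identityˡ x)) ⟨
      q · (p · (1# * x))   ≈⟨ ×-congʳ q (×-assoc-* p 1# x) ⟨
      q · ((p · 1#) * x)   ≈⟨ ×-congʳ q (*-congʳ p·1≈0) ⟩
      q · (0# * x)         ≈⟨ ×-congʳ q (zeroˡ x) ⟩
      q · 0#               ≈⟨ sum-replicate q ⟨
      sum {q} (λ _ → 0#)   ≈⟨ sum-replicate-zero q ⟩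
      0#                   ∎

    frobenius : ∀ x y → (x + y) ^ p ≈ x ^ p + y ^ p
    -- Writing p as `suc m` exposes the first and the last binomial term; p divides the coefficients
    -- of all terms between.
    frobenius x y = ≡.subst (λ e → (x + y) ^ e ≈ x ^ e + y ^ e) (≡.sym p≡) (begin
      (x + y) ^ suc m ≈⟨ theorem (suc m) x y ⟩
      t zero + sum (λ i → t (suc i)) ≈⟨ +-congˡ (sum-init-last (λ i → t (suc i))) ⟩
      t zero + (sum (λ i → t (suc (inject₁ i))) + t (suc (fromℕ m)))
        ≈⟨ +-cong first (+-cong (sum-zero _ (λ i → p∣n⇒n·≈0 (middle i) _)) last) ⟩
      y ^ suc m + (0# + x ^ suc m) ≈⟨ +-congˡ (+-identityˡ _) ⟩
      y ^ suc m + x ^ suc m ≈⟨ +-comm _ _ ⟩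
      x ^ suc m + y ^ suc m ∎)
      where
      m = ℕ.pred p
      p≡ : p ≡ suc m
      p≡ = ≡.sym (ℕ.suc-pred p {{prime⇒nonZero pr}})
      t = binomialTerm x y (suc m)
      first : t zero ≈ y ^ suc m
      first = trans (×-homo-1 _) (*-identityˡ _)
      middle : (i : Fin m) → p ℕ∣.∣ (suc m C toℕ (suc (inject₁ i)))
      middle i = ≡.subst (ℕ∣._∣ (suc m C toℕ (suc (inject₁ i)))) (≡.sym p≡)
        (prime∣binomial (≡.subst Prime p≡ pr) _ (s≤s (≡.subst (ℕ._< m) (≡.sym (Fin.toℕ-inject₁ i)) (Fin.toℕ<n i))))
      last : t (suc (fromℕ m)) ≈ x ^ suc m
      last rewrite Fin.toℕ-fromℕ m | nCn≡1 (suc m) | ℕ.n∸n≡0 m = trans (×-homo-1 _) (*-identityʳ _)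

    frobenius-iterate : ∀ u k → (1# + u) ^ (p ℕ.^ k) ≈ 1# + u ^ (p ℕ.^ k)
    frobenius-iterate u zero    = trans (*-identityʳ _) (+-congˡ (sym (*-identityʳ u)))
    frobenius-iterate u (suc k) = begin
      (1# + u) ^ (p ℕ.* p ℕ.^ k)   ≡⟨ ≡.cong ((1# + u) ^_) (ℕ.*-comm p (p ℕ.^ k)) ⟩
      (1# + u) ^ (p ℕ.^ k ℕ.* p)   ≈⟨ ^-assocʳ _ (p ℕ.^ k) p ⟨
      ((1# + u) ^ (p ℕ.^ k)) ^ p   ≈⟨ ^-congˡ p (frobenius-iterate u k) ⟩
      (1# + u ^ (p ℕ.^ k)) ^ p     ≈⟨ frobenius 1# _ ⟩
      1# ^ p + (u ^ (p ℕ.^ k)) ^ p ≈⟨ +-cong (1^ p) (^-assocʳ u (p ℕ.^ k) p) ⟩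
      1# + u ^ (p ℕ.^ k ℕ.* p)     ≡⟨ ≡.cong (λ e → 1# + u ^ e) (ℕ.*-comm (p ℕ.^ k) p) ⟩
      1# + u ^ (p ℕ.* p ℕ.^ k)     ∎

    -- For m = q p^k, iterated Frobenius gives (1 + u)^m = (1 + u^(p^k))^q, and `geometric` pulls
    -- out u^(p^k).
    u^pᵏ∣z^m-1 : ∀ u k {m} → p ℕ.^ k ℕ∣.∣ m → u ^ (p ℕ.^ k) ∣ (1# + u) ^ m - 1#
    u^pᵏ∣z^m-1 u k (ℕ∣.divides q ≡.refl) with geometric (u ^ (p ℕ.^ k)) q
    ... | g , eq = g , sym (begin
      (1# + u) ^ (q ℕ.* p ℕ.^ k) - 1#   ≡⟨ ≡.cong (λ e → (1# + u) ^ e - 1#) (ℕ.*-comm q (p ℕ.^ k)) ⟩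
      (1# + u) ^ (p ℕ.^ k ℕ.* q) - 1#   ≈⟨ +-congʳ (^-assocʳ _ (p ℕ.^ k) q) ⟨
      ((1# + u) ^ (p ℕ.^ k)) ^ q - 1#   ≈⟨ +-congʳ (^-congˡ q (frobenius-iterate u k)) ⟩
      (1# + u ^ (p ℕ.^ k)) ^ q - 1#     ≈⟨ +-congʳ eq ⟩
      1# + u ^ (p ℕ.^ k) * g - 1#       ≈⟨ xyx⁻¹≈y 1# _ ⟩
      u ^ (p ℕ.^ k) * g                 ≈⟨ *-comm _ _ ⟩
      g * u ^ (p ℕ.^ k)                 ∎)

-- Newton basis polynomials and Gaussian binomials.

module GaussianBinomial {c ℓ} (R : CommutativeRing c ℓ) (z : CommutativeRing.Carrier R) where
  open CommutativeRing R hiding (zero)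
  open SetoidReasoning setoid
  open import Algebra.Properties.Semiring.Exp semiring
  open import Algebra.Properties.Ring ring using (x[y-z]≈xy-xz; //-rightDividesˡ)
  open import Algebra.Solver.Ring.NaturalCoefficients.Default commutativeSemiring

  -- The Newton basis polynomial for the nodes 1, z, z², ...: the product of y - z^l over l < d.
  falling : ℕ → Carrier → Carrier
  falling zero    y = 1#
  falling (suc d) y = falling d y * (y - z ^ d)

  -- [x choose d]_z through its Pascal rule, which avoids the quotient formula: the denominators
  -- there need not be invertible.
  gauss : ℕ → ℕ → Carrier
  gauss zero    zero    = 1#
  gauss zero    (suc d) = 0#
  gauss (suc x) zero    = 1#
  gauss (suc x) (suc d) = gauss x d + z ^ suc d * gauss x (suc d)

  -- ∏_{i<d} (z^d - z^i)
  gaussFactorial : ℕ → Carrier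
  gaussFactorial zero    = 1#
  gaussFactorial (suc d) = (z ^ suc d - 1#) * z ^ d * gaussFactorial d

  telescope : ∀ a b c → (a - b) + (c - a) ≈ c - b
  telescope a b c = begin
    (a - b) + (c - a)   ≈⟨ solve 4 (λ a c x y → (a :+ x) :+ (c :+ y) := (c :+ y) :+ a :+ x) refl a c (- b) (- a) ⟩
    (c - a) + a - b     ≈⟨ +-congʳ (//-rightDividesˡ a c) ⟩
    c - b               ∎

  *-falling : ∀ d y → y * falling d y ≈ falling (suc d) y + z ^ d * falling d y
  *-falling d y = begin
    y * falling d y                             ≈⟨ *-congʳ (//-rightDividesˡ (z ^ d) y) ⟨
    (y - z ^ d + z ^ d) * falling d y           ≈⟨ solve 3 (λ s a f → (s :+ a) :* f := f :* s :+ a :* f) refl (y - z ^ d) (z ^ d) (falling d y) ⟩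
    falling (suc d) y + z ^ d * falling d y     ∎

  -- The factor of the node 1 is set apart; from each of the other d factors a z comes out, which
  -- moves the node z^(l+1) to z^l.
  falling-z* : ∀ d y → falling (suc d) (z * y) ≈ (z * y - 1#) * z ^ d * falling d y
  falling-z* zero    y = solve 1 (λ s → con 1 :* s := s :* con 1 :* con 1) refl (z * y - 1#)
  falling-z* (suc d) y = begin
    falling (suc d) (z * y) * (z * y - z * z ^ d)
      ≈⟨ *-cong (falling-z* d y) (sym (x[y-z]≈xy-xz z y (z ^ d))) ⟩
    (z * y - 1#) * z ^ d * falling d y * (z * (y - z ^ d))
      ≈⟨ solve 5 (λ s a f z t → s :* a :* f :* (z :* t) := s :* (z :* a) :* (f :* t)) refl _ _ _ _ _ ⟩
    (z * y - 1#) * z ^ suc d * falling (suc d) y ∎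

  falling-one : ∀ d → falling (suc d) 1# ≈ 0#
  falling-one zero    = trans (*-identityˡ _) (-‿inverseʳ 1#)
  falling-one (suc d) = trans (*-congʳ (falling-one d)) (zeroˡ _)

  -- The product formula for Gaussian binomials with denominators cleared, by induction on x along
  -- the Pascal rule.
  falling-gauss : ∀ x d → falling d (z ^ x) ≈ gauss x d * gaussFactorial d
  falling-gauss zero    zero    = sym (*-identityˡ _)
  falling-gauss zero    (suc d) = trans (falling-one d) (sym (zeroˡ _))
  falling-gauss (suc x) zero    = sym (*-identityˡ _)
  falling-gauss (suc x) (suc d) = begin
    falling (suc d) (z * z ^ x)
      ≈⟨ falling-z* d (z ^ x) ⟩
    (z * z ^ x - 1#) * z ^ d * f
      ≈⟨ *-congʳ (*-congʳ (telescope (z ^ suc d) 1# (z * z ^ x))) ⟨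
    -- The split z^(x+1) - 1 = (z^(d+1) - 1) + z (z^x - z^d) produces the two terms of the Pascal
    -- rule.
    ((z ^ suc d - 1#) + (z * z ^ x - z * z ^ d)) * z ^ d * f
      ≈⟨ *-congʳ (*-congʳ (+-congˡ (x[y-z]≈xy-xz z (z ^ x) (z ^ d)))) ⟨
    ((z ^ suc d - 1#) + z * (z ^ x - z ^ d)) * z ^ d * f
      ≈⟨ solve 5 (λ s z t a f → (s :+ z :* t) :* a :* f := s :* a :* f :+ z :* a :* (f :* t)) refl
           (z ^ suc d - 1#) z (z ^ x - z ^ d) (z ^ d) f ⟩
    (z ^ suc d - 1#) * z ^ d * f + z ^ suc d * falling (suc d) (z ^ x)
      ≈⟨ +-cong (*-congˡ (falling-gauss x d)) (*-congˡ (falling-gauss x (suc d))) ⟩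
    (z ^ suc d - 1#) * z ^ d * (gauss x d * gaussFactorial d) + z ^ suc d * (gauss x (suc d) * gaussFactorial (suc d))
      ≈⟨ solve 6 (λ s a g w b h → s :* a :* (g :* w) :+ b :* (h :* (s :* a :* w)) := (g :+ b :* h) :* (s :* a :* w)) refl
           (z ^ suc d - 1#) (z ^ d) (gauss x d) (gaussFactorial d) (z ^ suc d) (gauss x (suc d)) ⟩
    gauss (suc x) (suc d) * gaussFactorial (suc d) ∎
    where f = falling d (z ^ x)

-- The order of u in the product of z^d - z^l over l < d.

module Valuation {c ℓ} (R : CommutativeRing c ℓ) (p : ℕ) (pr : Prime p) where
  open CommutativeRing R hiding (zero)
  open import Algebra.Properties.Semiring.Exp semiring
  open import Algebra.Properties.Semiring.Mult semiring using () renaming (_×_ to _·_)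
  open import Algebra.Properties.CommutativeSemigroup.Divisibility *-commutativeSemigroup
    using (_∣_; ∣ʳ-respˡ-≈; ∣ʳ-respʳ-≈; ∙-cong-∣; x∣ʳy⇒x∣ʳzy)
  open import Algebra.Properties.Monoid.Divisibility *-monoid using (∣ʳ-refl)
  open import Algebra.Properties.CommutativeSemigroup *-commutativeSemigroup using (x∙yz≈xy∙z)
  open Frobenius R p pr

  module _ (p·1≈0 : p · 1# ≈ 0#) (u : Carrier) where
    open GaussianBinomial R (1# + u)

    -- r and s are the two lowest base-p digits of d.  When one of them rolls over,
    -- d + 1 is divisible by p or p², and this pays for its disappearance from the bound.
    record LowDigits (d : ℕ) : Set (c ⊔ ℓ) where
      constructor lowDigits
      field
        {w r s t} : ℕ
        digits : d ≡ r ℕ.+ p ℕ.* (s ℕ.+ p ℕ.* t)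
        r<p    : r ℕ.< p
        s<p    : s ℕ.< p
        bound  : 2 ℕ.* d ℕ.≤ w ℕ.+ (r ℕ.+ s)
        u^w∣   : u ^ w ∣ gaussFactorial d

    private
      0<p : 0 ℕ.< p
      0<p = ℕ.>-nonZero⁻¹ p {{prime⇒nonZero pr}}

      2≤p : 2 ℕ.≤ p
      2≤p = ℕ.nonTrivial⇒n>1 p {{prime⇒nonTrivial pr}}

      raise : ∀ {d b b′} → 2 ℕ.* d ℕ.≤ b → 2 ℕ.+ b ℕ.≤ b′ → 2 ℕ.* suc d ℕ.≤ b′
      raise {d} 2d≤b h = ℕ.≤-trans (ℕ.≤-reflexive (ℕ.*-suc 2 d)) (ℕ.≤-trans (ℕ.+-monoʳ-≤ 2 2d≤b) h)

      -- The step from d to d + 1 brings in the factor z^(d+1) - 1, divisible by u^(p^k); the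
      -- further factor z^d does no harm.
      extend : ∀ {d w} k → p ℕ.^ k ℕ∣.∣ suc d → u ^ w ∣ gaussFactorial d →
               u ^ (p ℕ.^ k ℕ.+ w) ∣ gaussFactorial (suc d)
      extend {d} {w} k pᵏ∣ u^w∣ =
        ∣ʳ-respˡ-≈ (sym (^-homo-* u (p ℕ.^ k) w))
          (∣ʳ-respʳ-≈ (x∙yz≈xy∙z _ _ _)
            (∙-cong-∣ (u^pᵏ∣z^m-1 p·1≈0 u k pᵏ∣) (x∣ʳy⇒x∣ʳzy ((1# + u) ^ d) u^w∣)))

    lowDigits-of : ∀ d → LowDigits d
    lowDigits-of zero = lowDigits {w = 0} {0} {0} {0}
      (≡.sym (≡.trans (≡.cong (p ℕ.*_) (ℕ.*-zeroʳ p)) (ℕ.*-zeroʳ p))) 0<p 0<p z≤n ∣ʳ-refl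
    lowDigits-of (suc d) with lowDigits-of d
    ... | lowDigits {w} {r} {s} {t} eq r<p s<p 2d≤ u^w∣ with suc r ℕ.<? p
    -- No carry: the exponent and `r` both grow by 1, which pays for the increase of 2 d by 2.
    ... | yes r+1<p = lowDigits {w = suc w} {suc r} {s} {t} (≡.cong suc eq) r+1<p s<p
                        (raise 2d≤ (ℕ.≤-reflexive (arith w r s)))
                        (extend {w = w} 0 (ℕ∣.1∣ suc d) u^w∣)
      where
      arith : ∀ w r s → 2 ℕ.+ (w ℕ.+ (r ℕ.+ s)) ≡ suc w ℕ.+ (suc r ℕ.+ s)
      arith = ℕSolver.solve-∀
    ... | no r+1≮p with suc s ℕ.<? p
    -- One carry: the exponent gains p, `r` loses p - 1 and `s` gains 1, again 2 in total.
    ...   | yes s+1<p = lowDigits {w = p ℕ.^ 1 ℕ.+ w} {0} {suc s} {t} eq′ 0<p s+1<p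
                        (raise 2d≤ (ℕ.≤-reflexive step))
                        (extend {w = w} 1 (ℕ∣.divides (suc s ℕ.+ p ℕ.* t) (≡.trans eq′ (swap p (suc s ℕ.+ p ℕ.* t)))) u^w∣)
      where
      r+1≡p : suc r ≡ p
      r+1≡p = ℕ.≤-antisym r<p (ℕ.≮⇒≥ r+1≮p)
      swap : ∀ p x → p ℕ.* x ≡ x ℕ.* (p ℕ.* 1)
      swap = ℕSolver.solve-∀
      eq′ : suc d ≡ p ℕ.* (suc s ℕ.+ p ℕ.* t)
      eq′ = ≡.trans (≡.cong suc eq) (≡.trans (≡.cong (ℕ._+ p ℕ.* (s ℕ.+ p ℕ.* t)) r+1≡p) (≡.sym (ℕ.*-suc p (s ℕ.+ p ℕ.* t))))
      arith : ∀ w r s → 2 ℕ.+ (w ℕ.+ (r ℕ.+ s)) ≡ suc r ℕ.* 1 ℕ.+ w ℕ.+ (0 ℕ.+ suc s)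
      arith = ℕSolver.solve-∀
      step : 2 ℕ.+ (w ℕ.+ (r ℕ.+ s)) ≡ p ℕ.* 1 ℕ.+ w ℕ.+ (0 ℕ.+ suc s)
      step = ≡.trans (arith w r s) (≡.cong (λ x → x ℕ.* 1 ℕ.+ w ℕ.+ suc s) r+1≡p)
    -- Two carries: the exponent gains p² and the digits lose 2 (p - 1), a net gain of at least 2
    -- because p ≥ 2.
    ...   | no s+1≮p = lowDigits {w = p ℕ.^ 2 ℕ.+ w} {0} {0} {suc t} eq′ 0<p 0<p
                        (raise 2d≤ step)
                        (extend {w = w} 2 (ℕ∣.divides (suc t) (≡.trans eq′ (swap p (suc t)))) u^w∣)
      where
      r+1≡p : suc r ≡ p
      r+1≡p = ℕ.≤-antisym r<p (ℕ.≮⇒≥ r+1≮p)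
      s+1≡p : suc s ≡ p
      s+1≡p = ℕ.≤-antisym s<p (ℕ.≮⇒≥ s+1≮p)
      swap : ∀ p x → p ℕ.* (p ℕ.* x) ≡ x ℕ.* (p ℕ.* (p ℕ.* 1))
      swap = ℕSolver.solve-∀
      eq′ : suc d ≡ p ℕ.* (0 ℕ.+ p ℕ.* suc t)
      eq′ = ≡.trans (≡.cong suc eq) (≡.trans (≡.cong (ℕ._+ p ℕ.* (s ℕ.+ p ℕ.* t)) r+1≡p)
              (≡.trans (≡.sym (ℕ.*-suc p (s ℕ.+ p ℕ.* t)))
                (≡.cong (p ℕ.*_) (≡.trans (≡.cong (ℕ._+ p ℕ.* t) s+1≡p) (≡.sym (ℕ.*-suc p t))))))
      arith : ∀ w r s → 2 ℕ.+ (w ℕ.+ (r ℕ.+ s)) ≡ suc r ℕ.+ suc s ℕ.+ w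
      arith = ℕSolver.solve-∀
      arith′ : ∀ p w → p ℕ.+ p ℕ.+ w ≡ 2 ℕ.* (p ℕ.* 1) ℕ.+ w
      arith′ = ℕSolver.solve-∀
      step : 2 ℕ.+ (w ℕ.+ (r ℕ.+ s)) ℕ.≤ p ℕ.^ 2 ℕ.+ w ℕ.+ 0
      step = ℕ.≤-trans
        (ℕ.≤-reflexive (≡.trans (arith w r s) (≡.trans (≡.cong₂ (λ x y → x ℕ.+ y ℕ.+ w) r+1≡p s+1≡p) (arith′ p w))))
        (ℕ.≤-trans (ℕ.+-monoˡ-≤ w (ℕ.*-monoˡ-≤ (p ℕ.* 1) 2≤p)) (ℕ.≤-reflexive (≡.sym (ℕ.+-identityʳ _))))

-- Spans of functions and linear dependence.

module Spans {c ℓ} (F : CommutativeRing c ℓ) (Col : Set) where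
  open CommutativeRing F hiding (zero)
  open SetoidReasoning setoid
  open import Algebra.Solver.Ring.NaturalCoefficients.Default commutativeSemiring
  open import Algebra.Properties.Ring ring using (-‿distribˡ-*; -‿distribʳ-*)
  open import Algebra.Properties.Semiring.Sum semiring

  -- An inductive closure, so that membership proofs carry no coefficient vectors; `resp` closes it
  -- under pointwise equality in `F`.
  data Span (L : List (Col → Carrier)) : (Col → Carrier) → Set (c ⊔ ℓ) where
    gen   : ∀ {f} → f ∈ L → Span L f
    0∈    : Span L (λ _ → 0#)
    +∈    : ∀ {f g} → Span L f → Span L g → Span L (λ x → f x + g x)
    *∈    : ∀ a {f} → Span L f → Span L (λ x → a * f x)
    resp  : ∀ {f g} → (∀ x → f x ≈ g x) → Span L f → Span L g

  Span-mono : ∀ {L L′} → (∀ {f} → f ∈ L → f ∈ L′) → ∀ {f} → Span L f → Span L′ f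
  Span-mono L⊆ (gen i)    = gen (L⊆ i)
  Span-mono L⊆ 0∈         = 0∈
  Span-mono L⊆ (+∈ s t)   = +∈ (Span-mono L⊆ s) (Span-mono L⊆ t)
  Span-mono L⊆ (*∈ a s)   = *∈ a (Span-mono L⊆ s)
  Span-mono L⊆ (resp e s) = resp e (Span-mono L⊆ s)

  Span-[] : ∀ {f} → Span [] f → ∀ x → f x ≈ 0#
  Span-[] 0∈         x = refl
  Span-[] (+∈ s t)   x = trans (+-cong (Span-[] s x) (Span-[] t x)) (+-identityˡ 0#)
  Span-[] (*∈ a s)   x = trans (*-congˡ (Span-[] s x)) (zeroʳ a)
  Span-[] (resp e s) x = trans (sym (e x)) (Span-[] s x)

  -- The coefficient of `g` is read off from the derivation; the elimination below works with it.
  Span-∷ : ∀ {g L f} → Span (g ∷ L) f → ∃ λ a → ∃ λ f′ → Span L f′ × (∀ x → f x ≈ a * g x + f′ x)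
  Span-∷ (gen (here ≡.refl)) = 1# , _ , 0∈ , λ x → sym (trans (+-identityʳ _) (*-identityˡ _))
  Span-∷ (gen (there i)) = 0# , _ , gen i , λ x → sym (trans (+-congʳ (zeroˡ _)) (+-identityˡ _))
  Span-∷ 0∈ = 0# , _ , 0∈ , λ x → sym (trans (+-congʳ (zeroˡ _)) (+-identityˡ _))
  Span-∷ (+∈ s t) with Span-∷ s | Span-∷ t
  ... | a , f , s′ , e | b , h , t′ , e′ = a + b , _ , +∈ s′ t′ , λ x →
    trans (+-cong (e x) (e′ x))
      (solve 5 (λ a b g f h → (a :* g :+ f) :+ (b :* g :+ h) := (a :+ b) :* g :+ (f :+ h)) refl a b _ (f x) (h x))
  Span-∷ (*∈ b s) with Span-∷ s
  ... | a , f , s′ , e = b * a , _ , *∈ b s′ , λ x →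
    trans (*-congˡ (e x)) (solve 4 (λ a b g f → b :* (a :* g :+ f) := b :* a :* g :+ b :* f) refl a b _ (f x))
  Span-∷ (resp e s) with Span-∷ s
  ... | a , f , s′ , e′ = a , f , s′ , λ x → trans (sym (e x)) (e′ x)

  module _ (_≈0? : ∀ a → Dec (a ≈ 0#)) (1≉0 : 1# ≉ 0#)
           (integral : ∀ {a b} → a * b ≈ 0# → a ≈ 0# ⊎ b ≈ 0#) where

    -- Division-free Gaussian elimination.
    dependent : ∀ L {t} (f : Fin t → Col → Carrier) → (∀ i → Span L (f i)) → length L ℕ.< t →
                ∃ λ (a : Fin t → Carrier) → (∃ λ i → a i ≉ 0#) × (∀ x → sum (λ i → a i * f i x) ≈ 0#)
    dependent [] {suc t} f f∈ _ = (λ _ → 1#) , (zero , 1≉0) , λ x →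
      trans (sum-cong-≋ {suc t} (λ i → trans (*-identityˡ _) (Span-[] (f∈ i) x))) (sum-replicate-zero (suc t))
    dependent (g ∷ L) {suc t} f f∈ (s≤s L<t) with Fin.any? (λ i → ¬? (proj₁ (Span-∷ (f∈ i)) ≈0?))
    -- Without a pivot, all the functions already lie in the span of `L`.
    ... | no all0 = dependent L f
      (λ i → let a , f′ , s , e = Span-∷ (f∈ i) in
         resp (λ x → sym (trans (e x) (trans (+-congʳ (trans (*-congʳ (decidable-stable (a ≈0?) (λ a≉0 → all0 (i , a≉0)))) (zeroˡ _))) (+-identityˡ _)))) s)
      (ℕ.m<n⇒m<1+n L<t)
    -- With pivot i, the combinations a_i f_j - a_j f_i for j ≠ i lie in the span of `L`; a relation
    -- among them lifts to one among the f_j.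
    ... | yes (i , aᵢ≉0) = coeff , (punchIn i j , coeffⱼ≉0) , vanishes
      where
      a : Fin (suc t) → Carrier
      a i = proj₁ (Span-∷ (f∈ i))
      rearrange : ∀ b a f a′ f′ → b * a * (- f) + a′ * b * f′ ≈ b * (a′ * f′ - a * f)
      rearrange b a f a′ f′ = begin
        b * a * (- f) + a′ * b * f′     ≈⟨ solve 5 (λ b a f a′ f′ → b :* a :* f :+ a′ :* b :* f′ := b :* (a′ :* f′ :+ a :* f)) refl b a (- f) a′ f′ ⟩
        b * (a′ * f′ + a * (- f))       ≈⟨ *-congˡ (+-congˡ (-‿distribʳ-* a f)) ⟨
        b * (a′ * f′ - a * f)           ∎
      eliminated : ∀ j → Span L (λ x → a i * f (punchIn i j) x - a (punchIn i j) * f i x)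
      eliminated j = let b , h , s , e = Span-∷ (f∈ (punchIn i j)) ; _ , hᵢ , sᵢ , eᵢ = Span-∷ (f∈ i) in
        resp (λ x → sym (begin
          a i * f (punchIn i j) x - b * f i x
            ≈⟨ +-cong (*-congˡ (e x)) (trans (-‿distribˡ-* b _) (*-congˡ (eᵢ x))) ⟩
          a i * (b * g x + h x) + (- b) * (a i * g x + hᵢ x)
            ≈⟨ solve 6 (λ a b b′ g h h′ → a :* (b :* g :+ h) :+ b′ :* (a :* g :+ h′) := (b :+ b′) :* (a :* g) :+ (a :* h :+ b′ :* h′)) refl (a i) b (- b) (g x) (h x) (hᵢ x) ⟩
          (b - b) * (a i * g x) + (a i * h x + (- b) * hᵢ x)
            ≈⟨ +-congʳ (trans (*-congʳ (-‿inverseʳ b)) (zeroˡ _)) ⟩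
          0# + (a i * h x + (- b) * hᵢ x)
            ≈⟨ +-identityˡ _ ⟩
          a i * h x + (- b) * hᵢ x ∎))
          (+∈ (*∈ (a i) s) (*∈ (- b) sᵢ))
      ih : ∃ λ (b : Fin t → Carrier) → (∃ λ j → b j ≉ 0#) ×
             (∀ x → sum (λ j → b j * (a i * f (punchIn i j) x - a (punchIn i j) * f i x)) ≈ 0#)
      ih = dependent L (λ j x → a i * f (punchIn i j) x - a (punchIn i j) * f i x) eliminated L<t
      b : Fin t → Carrier
      b = proj₁ ih
      j : Fin t
      j = proj₁ (proj₁ (proj₂ ih))
      -- The coefficient that f_i collects when the relation among the eliminated functions is
      -- expanded.
      pivot : Carrier
      pivot = - sum (λ j → b j * a (punchIn i j))
      coeff : Fin (suc t) → Carrier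
      coeff = insertAt (λ j → a i * b j) i pivot
      coeffⱼ≉0 : coeff (punchIn i j) ≉ 0#
      -- The coefficient is a_i b_j: absence of zero divisors takes the place of division.
      coeffⱼ≉0 z = [ aᵢ≉0 , proj₂ (proj₁ (proj₂ ih)) ]′
        (integral (trans (sym (reflexive (insertAt-punchIn (λ j → a i * b j) i pivot j))) z))
      vanishes : ∀ x → sum (λ k → coeff k * f k x) ≈ 0#
      vanishes x = begin
        sum (λ k → coeff k * f k x)
          ≈⟨ sum-remove {i = i} (λ k → coeff k * f k x) ⟩
        coeff i * f i x + sum (λ j → coeff (punchIn i j) * f (punchIn i j) x)
          ≈⟨ +-cong (*-congʳ (reflexive (insertAt-lookup (λ j → a i * b j) i pivot)))
                    (sum-cong-≋ (λ j → *-congʳ (reflexive (insertAt-punchIn (λ j → a i * b j) i pivot j)))) ⟩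
        pivot * f i x + sum (λ j → a i * b j * f (punchIn i j) x)
          ≈⟨ +-congʳ (trans (sym (-‿distribˡ-* _ _)) (trans (-‿distribʳ-* _ _)
               (*-distribʳ-sum (- f i x) (λ j → b j * a (punchIn i j))))) ⟩
        sum (λ j → b j * a (punchIn i j) * (- f i x)) + sum (λ j → a i * b j * f (punchIn i j) x)
          ≈⟨ ∑-distrib-+ (λ j → b j * a (punchIn i j) * (- f i x)) (λ j → a i * b j * f (punchIn i j) x) ⟨
        sum (λ j → b j * a (punchIn i j) * (- f i x) + a i * b j * f (punchIn i j) x)
          ≈⟨ sum-cong-≋ (λ j → rearrange (b j) (a (punchIn i j)) (f i x) (a i) (f (punchIn i j) x)) ⟩
        sum (λ j → b j * (a i * f (punchIn i j) x - a (punchIn i j) * f i x))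
          ≈⟨ proj₂ (proj₂ ih) x ⟩
        0# ∎

-- Rows of the matrix as coefficients of powers of z.

module Rows {c ℓ} (F : CommutativeRing c ℓ) (p : ℕ) (pr : Prime p) where
  open CommutativeRing F hiding (zero)
  open import Algebra.Properties.Semiring.Mult semiring using () renaming (_×_ to _·_)
  open PowerSeries F
  private module A = CommutativeRing seriesRing
  open import Algebra.Properties.Semiring.Exp A.semiring using (^-homo-*; ^-assocʳ; ^-congʳ)
  open import Algebra.Properties.CommutativeSemigroup.Divisibility A.*-commutativeSemigroup using (_,_)
  open GaussianBinomial seriesRing Z

  module _ (p·1≈0 : p · 1# ≈ 0#) where

    p⋆×1≐0 : p ⋆× const 1# ≐ (λ _ → 0#)
    p⋆×1≐0 zero    = trans (⋆×-const p 0) p·1≈0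
    p⋆×1≐0 (suc k) = ⋆×-const p (suc k)

    module _ (k : ℕ) .{{_ : NonZero (p ℕ.^ k)}} where
      private
        q : ℕ
        q = p ℕ.^ k

      -- By Frobenius z^q = 1 + u^q, which agrees with 1 in degrees below q.
      Z^q⋆ : ∀ f {i} → i ℕ.< q → (Z ⋆^ q ⋆ f) i ≈ f i
      Z^q⋆ f {i} i<q =
        trans (⋆-cong (Frobenius.frobenius-iterate seriesRing p pr p⋆×1≐0 X k) (λ _ → refl) i)
        (trans (⋆-distribʳ f (const 1#) (X ⋆^ q) i)
        (trans (+-cong (⋆-identityˡ f i) (X^⋆-< q f i<q)) (+-identityʳ _)))

      Z^-periodic : ∀ s t {i} → i ℕ.< q → (Z ⋆^ (s ℕ.+ t ℕ.* q)) i ≈ (Z ⋆^ s) i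
      Z^-periodic s zero    {i} i<q = ^-congʳ Z (ℕ.+-identityʳ s) i
      Z^-periodic s (suc t) {i} i<q =
        trans (^-congʳ Z (reassoc s q (t ℕ.* q)) i)
        (trans (^-homo-* Z q (s ℕ.+ t ℕ.* q) i)
        (trans (Z^q⋆ (Z ⋆^ (s ℕ.+ t ℕ.* q)) i<q) (Z^-periodic s t i<q)))
        where
        reassoc : ∀ a b c → a ℕ.+ (b ℕ.+ c) ≡ b ℕ.+ (a ℕ.+ c)
        reassoc = ℕSolver.solve-∀

      top<q : ℕ.pred q ℕ.< q
      top<q = ℕ.≤-reflexive (ℕ.suc-pred q)

      -- The added exponent q - 1 - (c mod q) turns s ≡ c into an exponent ≡ -1 modulo q.
      -- Periodicity reduces s modulo q, and the new exponent is then compared with the degree q -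
      -- 1.
      indicator : ∀ s c → (Z ⋆^ (s ℕ.+ (ℕ.pred q ℕ.∸ c ℕ.% q))) (ℕ.pred q) ≈
                  (if does (s ℕ.% q ℕ.≟ c ℕ.% q) then 1# else 0#)
      indicator s c = trans (trans (^-congʳ Z exponent top) (Z^-periodic (s₀ ℕ.+ e) (s ℕ./ q) top<q)) reduced
        where
        top = ℕ.pred q
        s₀ = s ℕ.% q
        c₀ = c ℕ.% q
        e = top ℕ.∸ c₀
        c₀+e≡top : c₀ ℕ.+ e ≡ top
        c₀+e≡top = ℕ.m+[n∸m]≡n (ℕ.<⇒≤pred (ℕ.m%n<n c q))
        comm-tail : ∀ a b c → a ℕ.+ b ℕ.+ c ≡ a ℕ.+ c ℕ.+ b
        comm-tail = ℕSolver.solve-∀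
        exponent : s ℕ.+ e ≡ s₀ ℕ.+ e ℕ.+ s ℕ./ q ℕ.* q
        exponent = ≡.trans (≡.cong (ℕ._+ e) (ℕ.m≡m%n+[m/n]*n s q)) (comm-tail s₀ (s ℕ./ q ℕ.* q) e)
        reduced : (Z ⋆^ (s₀ ℕ.+ e)) top ≈ (if does (s₀ ℕ.≟ c₀) then 1# else 0#)
        reduced with ℕ.<-cmp s₀ c₀
        ... | tri< s<c s≢c _ rewrite dec-false (s₀ ℕ.≟ c₀) s≢c =
          Z^-> (s₀ ℕ.+ e) (≡.subst (s₀ ℕ.+ e ℕ.<_) c₀+e≡top (ℕ.+-monoˡ-< e s<c))
        ... | tri≈ _ s≡c _ rewrite dec-true (s₀ ℕ.≟ c₀) s≡c =
          trans (^-congʳ Z (≡.trans (≡.cong (ℕ._+ e) s≡c) c₀+e≡top) top) (Z^-leading top)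
        ... | tri> _ s≢c c<s rewrite dec-false (s₀ ℕ.≟ c₀) s≢c =
          -- The exponent is too large: it equals t + q with t < q - 1, so removing one period
          -- leaves a polynomial of degree below q - 1.
          trans (^-congʳ Z s+e≡t+q top) (trans (Z^-periodic t 1 top<q) (Z^-> t t<top))
          where
          t = s₀ ℕ.∸ suc c₀
          c+t≡s : suc c₀ ℕ.+ t ≡ s₀
          c+t≡s = ℕ.m+[n∸m]≡n c<s
          t<top : t ℕ.< top
          t<top = ℕ.<-≤-trans (≡.subst (t ℕ.<_) c+t≡s (ℕ.m<n+m t (s≤s z≤n))) (ℕ.<⇒≤pred (ℕ.m%n<n s q))
          shuffle : ∀ c t e → suc c ℕ.+ t ℕ.+ e ≡ t ℕ.+ suc (c ℕ.+ e)
          shuffle = ℕSolver.solve-∀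
          s+e≡t+q : s₀ ℕ.+ e ≡ t ℕ.+ 1 ℕ.* q
          s+e≡t+q = ≡.trans (≡.cong (ℕ._+ e) (≡.sym c+t≡s)) (≡.trans (shuffle c₀ t e)
            (≡.cong (t ℕ.+_) (≡.trans (≡.cong suc c₀+e≡top) (≡.trans (ℕ.suc-pred q) (≡.sym (ℕ.*-identityˡ q))))))

    -- Each of the two tracked digits is at most p - 1, whence a loss of 2 (p - 1) whatever d is.
    valuation : ∀ d → ∃ λ w → ∃ λ g →
                2 ℕ.* d ℕ.≤ w ℕ.+ 2 ℕ.* (p ℕ.∸ 1) × g ⋆ X ⋆^ w ≐ gaussFactorial d
    valuation d with Valuation.lowDigits-of seriesRing p pr p⋆×1≐0 X d
    ... | Valuation.lowDigits {w} {r} {s} _ r<p s<p bound (g , eq) =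
      w , g , ℕ.≤-trans bound (ℕ.+-monoʳ-≤ w (ℕ.≤-trans (ℕ.+-mono-≤ (≤p-1 r<p) (≤p-1 s<p))
        (ℕ.≤-reflexive (≡.cong ((p ℕ.∸ 1) ℕ.+_) (≡.sym (ℕ.+-identityʳ _)))))) , eq
      where
      ≤p-1 : ∀ {r} → r ℕ.< p → r ℕ.≤ p ℕ.∸ 1
      ≤p-1 r<p = ℕ.<⇒≤pred r<p

    -- The spanning set, its size, and the expansion of rows in it.

    module _ (Col : Set) where
      open Spans F Col

      mutual
        -- `H` accumulates the Gaussian binomials already chosen and `D` is the degree still to be
        -- spent. In `layers` the degree d of the current variable runs upwards while `D` runs down
        -- to 0.
        generators : ∀ m → (Fin m → Col → ℕ) → (Col → Series) → ℕ → List (Col → Carrier)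
        generators zero    y H D = applyUpTo (λ k x → H x k) (2 ℕ.* suc D)
        generators (suc m) y H D = layers m y H 0 D

        layers : ∀ m → (Fin (suc m) → Col → ℕ) → (Col → Series) → ℕ → ℕ → List (Col → Carrier)
        layers m y H d zero    = layer m y H d 0
        layers m y H d (suc D) = layer m y H d (suc D) ++ layers m y H (suc d) D

        layer : ∀ m → (Fin (suc m) → Col → ℕ) → (Col → Series) → ℕ → ℕ → List (Col → Carrier)
        layer m y H d D = generators m (y ∘ suc) (λ x → H x ⋆ gauss (y zero x) d) D

      mutual
        length-generators : ∀ m y H D → length (generators m y H D) ≡ 2 ℕ.* ((D ℕ.+ suc m) C suc m)
        length-generators zero    y H D = ≡.trans (List.length-applyUpTo (λ k x → H x k) (2 ℕ.* suc D))
          (≡.cong (2 ℕ.*_) (≡.sym (≡.trans (nC1≡n (D ℕ.+ 1)) (ℕ.+-comm D 1))))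
        length-generators (suc m) y H D = length-layers m y H 0 D

        -- A hockey-stick sum: Pascal's rule adds each layer to those after it, and the starting
        -- degree `d` does not affect the count.
        length-layers : ∀ m y H d D → length (layers m y H d D) ≡ 2 ℕ.* ((D ℕ.+ suc (suc m)) C suc (suc m))
        length-layers m y H d zero    = ≡.trans (length-generators m _ _ 0)
          (≡.cong (2 ℕ.*_) (≡.trans (nCn≡1 (suc m)) (≡.sym (nCn≡1 (suc (suc m))))))
        length-layers m y H d (suc D) = begin
          length (layer m y H d (suc D) ++ layers m y H (suc d) D)
            ≡⟨ List.length-++ (layer m y H d (suc D)) ⟩
          length (layer m y H d (suc D)) ℕ.+ length (layers m y H (suc d) D)
            ≡⟨ ≡.cong₂ ℕ._+_ (length-generators m _ _ (suc D)) (length-layers m y H (suc d) D) ⟩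
          2 ℕ.* ((suc D ℕ.+ suc m) C suc m) ℕ.+ 2 ℕ.* ((D ℕ.+ suc (suc m)) C suc (suc m))
            ≡⟨ ℕ.*-distribˡ-+ 2 ((suc D ℕ.+ suc m) C suc m) ((D ℕ.+ suc (suc m)) C suc (suc m)) ⟨
          2 ℕ.* ((suc D ℕ.+ suc m) C suc m ℕ.+ (D ℕ.+ suc (suc m)) C suc (suc m))
            ≡⟨ ≡.cong (λ e → 2 ℕ.* (e C suc m ℕ.+ (D ℕ.+ suc (suc m)) C suc (suc m))) (≡.sym (ℕ.+-suc D (suc m))) ⟩
          2 ℕ.* ((D ℕ.+ suc (suc m)) C suc m ℕ.+ (D ℕ.+ suc (suc m)) C suc (suc m))
            ≡⟨ ≡.cong (2 ℕ.*_) (nCk+nC[k+1]≡[n+1]C[k+1] (D ℕ.+ suc (suc m)) (suc m)) ⟩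
          2 ℕ.* ((suc D ℕ.+ suc (suc m)) C suc (suc m)) ∎
          where open ≡.≡-Reasoning

      layer⊆layers : ∀ m y H d e D {f} → f ∈ layer m y H (d ℕ.+ e) D → f ∈ layers m y H d (e ℕ.+ D)
      layer⊆layers m y H d zero    zero    f∈ rewrite ℕ.+-identityʳ d = f∈
      layer⊆layers m y H d zero    (suc D) f∈ rewrite ℕ.+-identityʳ d = ∈-++⁺ˡ f∈
      layer⊆layers m y H d (suc e) D       f∈ rewrite ℕ.+-suc d e =
        ∈-++⁺ʳ (layer m y H d (suc (e ℕ.+ D))) (layer⊆layers m y H (suc d) e D f∈)

      -- `g` is the same for all points of `Col`, so its coefficients are the scalars of a linear
      -- combination.
      Span-⋆ : ∀ {L} (h : Col → Series) g M → (∀ i → i ℕ.≤ M → Span L (λ x → h x i)) →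
               Span L (λ x → (h x ⋆ g) M)
      Span-⋆ h g zero    h∈ = resp (λ x → *-comm _ _) (*∈ (g 0) (h∈ 0 z≤n))
      Span-⋆ h g (suc M) h∈ = +∈ (resp (λ x → *-comm _ _) (*∈ (g (suc M)) (h∈ 0 z≤n)))
        (Span-⋆ (λ x → shift (h x)) g M (λ i i≤M → h∈ (suc i) (s≤s i≤M)))

      -- Induction on the variables, each expanded in the Newton basis. A term of degree d lowers 2
      -- D by 2 d, while its factor u^w lowers `M` by at least 2 d - 2 (p - 1). Each variable may
      -- thus waste 2 (p - 1), which the hypothesis reserves. The series `g` is arbitrary so that it
      -- can absorb all factors independent of the point.
      rows∈Span : ∀ m (y : Fin m → Col → ℕ) H D (b : Fin m → ℕ) g M →
        M ℕ.+ m ℕ.* (2 ℕ.* (p ℕ.∸ 1)) ℕ.≤ suc (2 ℕ.* D) →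
        Span (generators m y H D) (λ x → (H x ⋆ (Z ⋆^ sumF (λ j → y j x ℕ.* b j) ⋆ g)) M)
      -- Here M ≤ 2 D + 1, so the coefficients of `H` up to degree M are among the 2 (D + 1)
      -- generators.
      rows∈Span zero y H D b g M M≤ = Span-⋆ H (const 1# ⋆ g) M λ i i≤M →
        gen (∈-applyUpTo⁺ (λ k x → H x k) (s≤s (ℕ.≤-trans i≤M (ℕ.≤-trans (ℕ.≤-trans (ℕ.m≤m+n M 0) M≤)
          (ℕ.≤-reflexive (double D))))))
        where
        double : ∀ D → suc (2 ℕ.* D) ≡ D ℕ.+ suc (D ℕ.+ 0)
        double = ℕSolver.solve-∀
      rows∈Span (suc m) y H D b g M M≤ = resp split (newton (b zero) 0 g)
        where
        open import Algebra.Solver.Ring.NaturalCoefficients.Default A.commutativeSemiring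
        cost = 2 ℕ.* (p ℕ.∸ 1)
        Y : Col → Series
        Y x = Z ⋆^ y zero x
        rest : Col → Series
        rest x = Z ⋆^ sumF (λ j → y (suc j) x ℕ.* b (suc j))

        quotient : ℕ → Series → Series → Col → Series
        quotient d v g x = (H x ⋆ gauss (y zero x) d) ⋆ (rest x ⋆ (v ⋆ g))

        factor : ∀ d w v → v ⋆ X ⋆^ w ≐ gaussFactorial d → ∀ g x →
                 H x ⋆ (falling d (Y x) ⋆ (rest x ⋆ g)) ≐ X ⋆^ w ⋆ quotient d v g x
        factor d w v eq g x = A.trans
          (A.*-congˡ {H x} (A.*-congʳ {rest x ⋆ g} (A.trans (falling-gauss (y zero x) d)
            (A.*-congˡ {gauss (y zero x) d} (A.sym eq)))))
          (solve 6 (λ h a v u r g → h :* (a :* (v :* u) :* (r :* g)) := u :* ((h :* a) :* (r :* (v :* g)))) A.refl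
            (H x) (gauss (y zero x) d) v (X ⋆^ w) (rest x) g)

        -- A single Newton polynomial contributes a factor u^w: coefficient M is 0 if M < w, and
        -- otherwise it is coefficient M - w of `quotient`, to which the induction applies with
        -- degree D - d left.
        base : ∀ d g → Span (layers m y H 0 D) (λ x → (H x ⋆ (falling d (Y x) ⋆ (rest x ⋆ g))) M)
        base d g with valuation d
        ... | w , v , 2d≤ , eq with M ℕ.<? w
        ...   | yes M<w = resp (λ x → sym (trans (factor d w v eq g x M) (X^⋆-< w (quotient d v g x) M<w))) 0∈
        ...   | no M≮w = resp
          (λ x → sym (trans (factor d w v eq g x M)
            (trans (reflexive (≡.cong (X ⋆^ w ⋆ quotient d v g x) (≡.sym w+K≡M))) (X^⋆-+ w (quotient d v g x) K))))
          (≡.subst (λ e → Span (layers m y H 0 e) (λ x → quotient d v g x K)) d+D′≡D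
            (Span-mono (layer⊆layers m y H 0 d D′)
              (rows∈Span m (y ∘ suc) (λ x → H x ⋆ gauss (y zero x) d) D′ (b ∘ suc) (v ⋆ g) K K≤)))
          where
          K = M ℕ.∸ w
          w+K≡M : w ℕ.+ K ≡ M
          w+K≡M = ℕ.m+[n∸m]≡n (ℕ.≮⇒≥ M≮w)
          shuffle : ∀ w cost K r → (w ℕ.+ cost) ℕ.+ (K ℕ.+ r) ≡ w ℕ.+ K ℕ.+ (cost ℕ.+ r)
          shuffle = ℕSolver.solve-∀
          total : 2 ℕ.* d ℕ.+ (K ℕ.+ m ℕ.* cost) ℕ.≤ suc (2 ℕ.* D)
          total = ℕ.≤-trans (ℕ.+-monoˡ-≤ (K ℕ.+ m ℕ.* cost) 2d≤)
            (ℕ.≤-trans (ℕ.≤-reflexive (≡.trans (shuffle w cost K (m ℕ.* cost)) (≡.cong (ℕ._+ (cost ℕ.+ m ℕ.* cost)) w+K≡M))) M≤)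
          d≤D : d ℕ.≤ D
          -- Otherwise 2 D + 2 ≤ 2 d, against 2 d ≤ 2 D + 1 from `total`.
          d≤D = ℕ.≮⇒≥ λ D<d → ℕ.<⇒≱ (ℕ.n<1+n (suc (2 ℕ.* D)))
            (ℕ.≤-trans (ℕ.≤-reflexive (≡.sym (ℕ.*-suc 2 D)))
              (ℕ.≤-trans (ℕ.*-monoʳ-≤ 2 D<d) (ℕ.≤-trans (ℕ.m≤m+n (2 ℕ.* d) _) total)))
          D′ = D ℕ.∸ d
          d+D′≡D : d ℕ.+ D′ ≡ D
          d+D′≡D = ℕ.m+[n∸m]≡n d≤D
          double : ∀ d e → suc (2 ℕ.* (d ℕ.+ e)) ≡ 2 ℕ.* d ℕ.+ suc (2 ℕ.* e)
          double = ℕSolver.solve-∀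
          K≤ : K ℕ.+ m ℕ.* cost ℕ.≤ suc (2 ℕ.* D′)
          K≤ = ℕ.+-cancelˡ-≤ (2 ℕ.* d) _ _ (ℕ.≤-trans total
            (ℕ.≤-reflexive (≡.trans (≡.cong (λ e → suc (2 ℕ.* e)) (≡.sym d+D′≡D)) (double d D′))))

        -- Factors are taken from the power one at a time by `*-falling`. The factor z^d goes into
        -- `g`, so the interpolation coefficients are never written out.
        newton : ∀ n d g → Span (layers m y H 0 D) (λ x → (H x ⋆ (Y x ⋆^ n ⋆ falling d (Y x) ⋆ (rest x ⋆ g))) M)
        newton zero    d g = resp (λ x → A.*-congˡ {H x} (A.*-congʳ {rest x ⋆ g} (A.sym (⋆-identityˡ (falling d (Y x))))) M) (base d g)
        newton (suc n) d g = resp (λ x → expand x M) (+∈ (newton n (suc d) g) (newton n d (Z ⋆^ d ⋆ g)))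
          where
          expand : ∀ x → H x ⋆ (Y x ⋆^ n ⋆ falling (suc d) (Y x) ⋆ (rest x ⋆ g)) ⊹
                         H x ⋆ (Y x ⋆^ n ⋆ falling d (Y x) ⋆ (rest x ⋆ (Z ⋆^ d ⋆ g))) ≐
                         H x ⋆ (Y x ⋆^ suc n ⋆ falling d (Y x) ⋆ (rest x ⋆ g))
          expand x = A.trans
            (solve 7 (λ h a f′ r g f z → h :* (a :* f′ :* (r :* g)) :+ h :* (a :* f :* (r :* (z :* g))) :=
                                         h :* (a :* (f′ :+ z :* f) :* (r :* g))) A.refl
              (H x) (Y x ⋆^ n) (falling (suc d) (Y x)) (rest x) g (falling d (Y x)) (Z ⋆^ d))
            (A.trans (A.*-congˡ {H x} (A.*-congʳ {rest x ⋆ g} (A.*-congˡ {Y x ⋆^ n} (A.sym (*-falling d (Y x))))))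
            (solve 6 (λ h a y f r g → h :* (a :* (y :* f) :* (r :* g)) := h :* (y :* a :* f :* (r :* g))) A.refl
              (H x) (Y x ⋆^ n) (Y x) (falling d (Y x)) (rest x) g))

        split : ∀ x → (H x ⋆ (Y x ⋆^ b zero ⋆ falling 0 (Y x) ⋆ (rest x ⋆ g))) M ≈
                      (H x ⋆ (Z ⋆^ sumF (λ j → y j x ℕ.* b j) ⋆ g)) M
        split x = A.*-congˡ {H x} (A.trans
          (solve 3 (λ a r g → a :* con 1 :* (r :* g) := a :* r :* g) A.refl (Y x ⋆^ b zero) (rest x) g)
          (A.*-congʳ {g} (A.sym (A.trans (^-homo-* Z (y zero x ℕ.* b zero) _)
            (A.*-congʳ {rest x} (A.sym (^-assocʳ Z (y zero x) (b zero)))))))) M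

-- Separation of one coordinate, and concatenation of families of lists.

sumF-punchIn : ∀ {n} (f : Fin (suc n) → ℕ) i → sumF f ≡ f i ℕ.+ sumF (f ∘ punchIn i)
sumF-punchIn         f zero    = ≡.refl
sumF-punchIn {suc n} f (suc i) = ≡.trans (≡.cong (f zero ℕ.+_) (sumF-punchIn (f ∘ suc) i))
  (reassoc (f zero) (f (suc i)) (sumF (f ∘ suc ∘ punchIn i)))
  where
  reassoc : ∀ a b c → a ℕ.+ (b ℕ.+ c) ≡ b ℕ.+ (a ℕ.+ c)
  reassoc = ℕSolver.solve-∀

length-concat-tabulate : ∀ {A : Set} {n} (g : Fin n → List A) N → (∀ i → length (g i) ≡ N) →
                         length (concat (tabulate g)) ≡ n ℕ.* N
length-concat-tabulate {n = zero}  g N len = ≡.refl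
length-concat-tabulate {n = suc n} g N len = ≡.trans (List.length-++ (g zero))
  (≡.cong₂ ℕ._+_ (len zero) (length-concat-tabulate (g ∘ suc) N (len ∘ suc)))

∈-concat-tabulate : ∀ {A : Set} {n} (g : Fin n → List A) i {x} → x ∈ g i → x ∈ concat (tabulate g)
∈-concat-tabulate g zero    x∈ = ∈-++⁺ˡ x∈
∈-concat-tabulate g (suc i) x∈ = ∈-++⁺ʳ (g zero) (∈-concat-tabulate (g ∘ suc) i x∈)

module _ (q : ℕ) .{{_ : NonZero q}} where

  open Ring q

  -- The coordinate x_i enters with coefficient 1, so z^(x_i) can serve as the initial `H` and only
  -- the other coordinates are interpolated. The congruence for b_i also covers q = 1.
  dot-normalized : ∀ {m} (x b : Vect (suc m)) i → toℕ (b i) ℕ.% q ≡ 1 ℕ.% q →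
    dot x b ℕ.% q ≡ (toℕ (x i) ℕ.+ sumF (λ j → toℕ (x (punchIn i j)) ℕ.* toℕ (b (punchIn i j)))) ℕ.% q
  dot-normalized x b i bᵢ≡1 = begin
    dot x b ℕ.% q                     ≡⟨ ≡.cong (ℕ._% q) (sumF-punchIn (λ j → toℕ (x j) ℕ.* toℕ (b j)) i) ⟩
    (xᵢ ℕ.* bᵢ ℕ.+ s) ℕ.% q           ≡⟨ ℕ.%-distribˡ-+ (xᵢ ℕ.* bᵢ) s q ⟩
    ((xᵢ ℕ.* bᵢ) ℕ.% q ℕ.+ s ℕ.% q) ℕ.% q  ≡⟨ ≡.cong (λ e → (e ℕ.+ s ℕ.% q) ℕ.% q) scaled ⟩
    (xᵢ ℕ.% q ℕ.+ s ℕ.% q) ℕ.% q      ≡⟨ ℕ.%-distribˡ-+ xᵢ s q ⟨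
    (xᵢ ℕ.+ s) ℕ.% q                  ∎
    where
    open ≡.≡-Reasoning
    xᵢ = toℕ (x i)
    bᵢ = toℕ (b i)
    s = sumF (λ j → toℕ (x (punchIn i j)) ℕ.* toℕ (b (punchIn i j)))
    scaled : (xᵢ ℕ.* bᵢ) ℕ.% q ≡ xᵢ ℕ.% q
    scaled = begin
      (xᵢ ℕ.* bᵢ) ℕ.% q                   ≡⟨ ℕ.%-distribˡ-* xᵢ bᵢ q ⟩
      (xᵢ ℕ.% q ℕ.* (bᵢ ℕ.% q)) ℕ.% q     ≡⟨ ≡.cong (λ e → (xᵢ ℕ.% q ℕ.* e) ℕ.% q) bᵢ≡1 ⟩
      (xᵢ ℕ.% q ℕ.* (1 ℕ.% q)) ℕ.% q      ≡⟨ ℕ.%-distribˡ-* xᵢ 1 q ⟨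
      (xᵢ ℕ.* 1) ℕ.% q                    ≡⟨ ≡.cong (ℕ._% q) (ℕ.*-identityʳ xᵢ) ⟩
      xᵢ ℕ.% q                            ∎

-- The rank bound over the integers modulo p.

module _ (p : ℕ) (pr : Prime p) where

  open ModularIntegers p
  open CommutativeRing ring using (semiring; sym; trans; *-congʳ)
  open import Algebra.Properties.Semiring.Sum semiring using (sum; sum-cong-≋)
  open import Algebra.Properties.Semiring.Mult semiring using () renaming (_×_ to _·_)

  private instance
    nzp : NonZero p
    nzp = prime⇒nonZero pr

  +-sumF : ∀ {t} (f : Fin t → ℕ) → + sumF f ≡ sum (λ i → + f i)
  +-sumF {zero}  f = ≡.refl
  +-sumF {suc t} f = ≡.cong (λ s → + f zero ℤ.+ s) (+-sumF (f ∘ suc))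

  p·1≋0 : p · + 1 ≋ + 0
  p·1≋0 = trans (reflexive (·1 p)) (∣⇒≋0 ℕ∣.∣-refl)
    where
    ·1 : ∀ n → n · + 1 ≡ + n
    ·1 zero    = ≡.refl
    ·1 (suc n) = ≡.cong ℤ.suc (·1 n)

  1≋̸0 : ¬ (+ 1 ≋ + 0)
  1≋̸0 1≋0 = ℕ.<⇒≱ (ℕ.nonTrivial⇒n>1 p {{prime⇒nonTrivial pr}}) (ℕ∣.∣⇒≤ (≋0⇒∣ 1≋0))

  ≋%ℕ : ∀ a → + (a ℤ.%ℕ p) ≋ a
  ≋%ℕ a = sym (mod (ℤ∣.divides (a ℤ./ℕ p) (≡.trans
    (≡.cong (ℤ._- + (a ℤ.%ℕ p)) (ℤ.a≡a%ℕn+[a/ℕn]*n a p))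
    (cancel (+ (a ℤ.%ℕ p)) (a ℤ./ℕ p ℤ.* + p)))))
    where
    cancel : ∀ r s → r ℤ.+ s ℤ.- r ≡ s
    cancel = ℤSolver.solve-∀

  -- More than `length L` rows satisfy a nontrivial relation by `dependent`, which contradicts their
  -- independence.
  RankAtMost-span : ∀ {I Col : Set} (M : I → Col → ℕ) (L : List (Col → ℤ)) →
    (∀ r → Spans.Span ring Col L (λ x → + M r x)) → RankAtMost p M (length L)
  RankAtMost-span {Col = Col} M L rows∈ t r indep = ℕ.≮⇒≥ λ L<t →
    let a , (i , aᵢ≋̸0) , vanishes = dependent _≋0? 1≋̸0 (*-integral pr) L (λ i x → + M (r i) x) (λ i → rows∈ (r i)) L<t
        -- Independence is tested with natural coefficients, so the integers are replaced by their
        -- residues.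
        c = λ i → a i ℤ.%ℕ p
        combination : ∀ x → + sumF (λ i → c i ℕ.* M (r i) x) ≋ + 0
        combination x = trans (reflexive (+-sumF (λ i → c i ℕ.* M (r i) x)))
          (trans (sum-cong-≋ (λ i → trans (reflexive (ℤ.pos-* (c i) (M (r i) x))) (*-congʳ (≋%ℕ (a i)))))
            (vanishes x))
    in aᵢ≋̸0 (trans (sym (≋%ℕ (a i))) (∣⇒≋0 (indep c (λ x → ≋0⇒∣ (combination x)) i)))
    where open Spans ring Col

  module _ (k m : ℕ) where
    private
      q = p ℕ.^ k
      instance
        nzq : NonZero q
        nzq = ℕ.m^n≢0 p k
      D = q ℕ./ 2 ℕ.+ m ℕ.* (p ℕ.∸ 1)
      Col = AstarCol p pr k (suc m)

    open PowerSeries ring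
    open Rows ring p pr
    open Spans ring Col
    open import Algebra.Properties.Semiring.Exp (CommutativeRing.semiring seriesRing) using (^-homo-*)
    private module A = CommutativeRing seriesRing

    others : Fin (suc m) → Fin m → Col → ℕ
    others i j x = toℕ (x (punchIn i j))

    -- Generators for the directions with b_i = 1, as the affine charts of a projective space.
    chart : Fin (suc m) → List (Col → ℤ)
    chart i = generators p·1≋0 Col m (others i) (λ x → Z ⋆^ toℕ (x i)) D

    -- The inequality that `rows∈Span` asks for at M = q - 1. It explains `D`: q ≤ 2 ⌊q/2⌋ + 1, plus
    -- p - 1 for each interpolated coordinate.
    pred-q≤ : ℕ.pred q ℕ.+ m ℕ.* (2 ℕ.* (p ℕ.∸ 1)) ℕ.≤ suc (2 ℕ.* D)
    pred-q≤ = ℕ.≤-trans (ℕ.+-monoˡ-≤ (m ℕ.* (2 ℕ.* (p ℕ.∸ 1))) pred-q≤′) (ℕ.≤-reflexive (expand (q ℕ./ 2) m (p ℕ.∸ 1)))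
      where
      expand : ∀ h m s → suc (2 ℕ.* h) ℕ.+ m ℕ.* (2 ℕ.* s) ≡ suc (2 ℕ.* (h ℕ.+ m ℕ.* s))
      expand = ℕSolver.solve-∀
      q≤ : q ℕ.≤ suc (2 ℕ.* (q ℕ./ 2))
      q≤ = ℕ.≤-trans (ℕ.≤-reflexive (ℕ.m≡m%n+[m/n]*n q 2))
        (ℕ.+-mono-≤ (ℕ.<⇒≤pred (ℕ.m%n<n q 2)) (ℕ.≤-reflexive (ℕ.*-comm (q ℕ./ 2) 2)))
      pred-q≤′ : ℕ.pred q ℕ.≤ suc (2 ℕ.* (q ℕ./ 2))
      pred-q≤′ = ℕ.≤-trans (ℕ.pred[n]≤n {q}) q≤

    row∈chart : ∀ (r : AstarRow p pr k (suc m)) →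
                Span (chart (proj₁ (proj₂ (proj₂ r)))) (λ x → + Astar p pr k (suc m) r x)
    row∈chart r@(a , b , i , _ , bᵢ≡1 , _) = resp same
      (rows∈Span p·1≋0 Col m (others i) (λ x → Z ⋆^ toℕ (x i)) D (λ j → toℕ (b (punchIn i j))) (Z ⋆^ e) (ℕ.pred q) pred-q≤)
      where
      c = Ring.dot q a b
      e = ℕ.pred q ℕ.∸ c ℕ.% q
      rest : Col → ℕ
      rest x = sumF (λ j → others i j x ℕ.* toℕ (b (punchIn i j)))
      if-+ : ∀ (d : Bool) → (if d then + 1 else + 0) ≡ + (if d then 1 else 0)
      if-+ true  = ≡.refl
      if-+ false = ≡.refl
      same : ∀ x → (Z ⋆^ toℕ (x i) ⋆ (Z ⋆^ rest x ⋆ Z ⋆^ e)) (ℕ.pred q) ≋ + Astar p pr k (suc m) r x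
      same x = trans
        (A.trans (A.sym (⋆-assoc (Z ⋆^ toℕ (x i)) (Z ⋆^ rest x) (Z ⋆^ e)))
          (A.sym (A.trans (^-homo-* Z (toℕ (x i) ℕ.+ rest x) e) (A.*-congʳ {Z ⋆^ e} (^-homo-* Z (toℕ (x i)) (rest x))))) (ℕ.pred q))
        (trans (indicator p·1≋0 k (toℕ (x i) ℕ.+ rest x) c)
          (reflexive (≡.trans (if-+ (does ((toℕ (x i) ℕ.+ rest x) ℕ.% q ℕ.≟ c ℕ.% q)))
            (≡.cong (λ s → + (if does (s ℕ.≟ c ℕ.% q) then 1 else 0)) (≡.sym (dot-normalized q x b i bᵢ≡1))))))

    -- Each row lies in the chart named by its normalization witness, and the charts, one per
    -- coordinate, have equal size.
    Astar-rank : RankAtMost p (Astar p pr k (suc m)) (2 ℕ.* suc m ℕ.* ((D ℕ.+ suc m) C suc m))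
    Astar-rank = ≡.subst (RankAtMost p (Astar p pr k (suc m))) count
      (RankAtMost-span (Astar p pr k (suc m)) (concat (tabulate chart))
        (λ r → Span-mono (∈-concat-tabulate chart (proj₁ (proj₂ (proj₂ r)))) (row∈chart r)))
      where
      regroup : ∀ n b → n ℕ.* (2 ℕ.* b) ≡ 2 ℕ.* n ℕ.* b
      regroup = ℕSolver.solve-∀
      count : length (concat (tabulate chart)) ≡ 2 ℕ.* suc m ℕ.* ((D ℕ.+ suc m) C suc m)
      count = ≡.trans (length-concat-tabulate chart _ (λ i → length-generators p·1≋0 Col m (others i) (λ x → Z ⋆^ toℕ (x i)) D))
        (regroup (suc m) ((D ℕ.+ suc m) C suc m))

open import Data.Nat.Base using (_+_; _*_; _∸_; _^_; _≤_)
open import Data.Nat.DivMod using (_/_)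

theorem1p4 : (p : ℕ) (pr : Prime p) (k n : ℕ) →
    RankAtMost p (Astar p pr k n)
    (2 * n * (((p ^ k) / 2 + (n ∸ 1) * (p ∸ 1) + n) C n))
theorem1p4 p pr k zero    zero    r indep = z≤n
-- For n = 0 a direction would need an invertible coordinate, so the matrix has no rows.
theorem1p4 p pr k zero    (suc t) r indep with r zero
... | _ , _ , () , _
theorem1p4 p pr k (suc m) = Astar-rank p pr k m
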